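{- If $G$ is a $2$-connected graph, then $\mathrm{lec}(G)=\min\{3,\mathrm{rc}(G)\}$.
   Context: Graphs are finite, simple, undirected. Given an edge-colouring $\varphi:E(G)\to[1,k]$, a path is loose if it consists of exactly one edge, or of exactly two edges of different colours, or has at least three edges coloured with at least three distinct colours. $\mathrm{lec}(G)$ is the least $k$ for which there is an edge-colouring with $k$ colours such that every two distinct vertices are joined by a loose path. $\mathrm{rc}(G)$ (rainbow connection number) is the least $k$ for which there is an edge-colouring with $k$ colours such that every two distinct vertices are joined by a path whose edges have pairwise distinct colours. -}

module Defs where

open import Data.Nat using (ℕ; zero; suc; _≤_; _<_; _⊓_)
open import Data.Fin using (Fin)
open import Data.Bool using (Bool; true; false)
open import Data.List using (List; []; _∷_; length)
open import Data.List.Membership.Propositional using (_∈_)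
open import Data.List.Relation.Unary.Unique.Propositional using (Unique)
open import Data.List.Relation.Unary.All using (All)
open import Data.Product using (Σ; _×_; ∃; ∃-syntax)
open import Data.Sum using (_⊎_)
open import Relation.Binary.PropositionalEquality using (_≡_; _≢_)
open import Relation.Nullary using (¬_)

record Graph : Set where
  field
    n      : ℕ
    Adj    : Fin n → Fin n → Bool
    sym    : ∀ u v → Adj u v ≡ Adj v u
    irrefl : ∀ u → Adj u u ≡ false

module _ (G : Graph) where
  open Graph G

  data Walk : Fin n → Fin n → Set where
    []  : ∀ {u} → Walk u u
    _∷_ : ∀ {u w v} → Adj u w ≡ true → Walk w v → Walk u v

  verts : ∀ {u v} → Walk u v → List (Fin n)
  verts {u} []      = u ∷ []
  verts {u} (_ ∷ p) = u ∷ verts p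

  IsPath : ∀ {u v} → Walk u v → Set
  IsPath p = Unique (verts p)

  -- an edge-colouring with (at most) k colours; colours [1,k] are encoded as Fin k.
  -- Only values on edges matter; symmetry makes it a colouring of unordered edges.
  record EdgeColouring (k : ℕ) : Set where
    field
      col    : Fin n → Fin n → Fin k
      colSym : ∀ u v → col u v ≡ col v u

  colours : ∀ {k u v} → EdgeColouring k → Walk u v → List (Fin k)
  colours φ []                  = []
  colours φ (_∷_ {u} {w} _ p)   = EdgeColouring.col φ u w ∷ colours φ p

  ThreeDistinct : ∀ {k} → List (Fin k) → Set
  ThreeDistinct cs = ∃[ a ] ∃[ b ] ∃[ c ]
    (a ∈ cs × b ∈ cs × c ∈ cs × a ≢ b × b ≢ c × a ≢ c)

  LooseColours : ∀ {k} → List (Fin k) → Set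
  LooseColours cs = length cs ≡ 1
           ⊎ (∃[ a ] ∃[ b ] (cs ≡ a ∷ b ∷ [] × a ≢ b))
           ⊎ (3 ≤ length cs × ThreeDistinct cs)

  Loose : ∀ {k u v} → EdgeColouring k → Walk u v → Set
  Loose φ p = LooseColours (colours φ p)

  Rainbow : ∀ {k u v} → EdgeColouring k → Walk u v → Set
  Rainbow φ p = Unique (colours φ p)

  LooseConnecting : ∀ {k} → EdgeColouring k → Set
  LooseConnecting φ = ∀ u v → u ≢ v → ∃[ p ] (IsPath {u} {v} p × Loose φ p)

  RainbowConnecting : ∀ {k} → EdgeColouring k → Set
  RainbowConnecting φ = ∀ u v → u ≢ v → ∃[ p ] (IsPath {u} {v} p × Rainbow φ p)

  IsLec : ℕ → Set
  IsLec k = (∃[ φ ] LooseConnecting {k} φ)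
          × (∀ j → j < k → ¬ (∃[ φ ] LooseConnecting {j} φ))

  IsRc : ℕ → Set
  IsRc k = (∃[ φ ] RainbowConnecting {k} φ)
         × (∀ j → j < k → ¬ (∃[ φ ] RainbowConnecting {j} φ))

  Connected : Set
  Connected = ∀ u v → ∃[ p ] IsPath {u} {v} p

  ConnectedWithout : Fin n → Set
  ConnectedWithout x = ∀ u v → u ≢ x → v ≢ x →
    ∃[ p ] (IsPath {u} {v} p × All (_≢ x) (verts p))

  TwoConnected : Set
  TwoConnected = 3 ≤ n × Connected × (∀ x → ConnectedWithout x)

{-# OPTIONS --safe #-}
module Submission where

-- The point is a 3-colouring that loosely connects every 2-connected graph. Fix an edge st and
-- colour it 2; the other edges at s get 0, the other edges at t get 1. By 2-connectedness,
-- distinct u, v outside {s, t} are linked to {s, t} by disjoint paths, and joining these through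
-- st gives a path with the colours 0, 2, 1. For the pairs involving s or t only vertices adjacent
-- to neither matter: edges from them to N(s) get colour 1, to N(t) ∖ N(s) colour 0, and all
-- remaining edges colour 2; leaving the set of such vertices along any path and then moving
-- on to s or t yields a loose path.
-- Finally, with fewer than three colours loose and rainbow paths coincide, and rainbow paths are
-- always loose. The number rc(G) itself is found by exhaustive search, bounded by the colouring
-- with all edges distinct.

open import Defs
open import Data.Nat using (ℕ; zero; suc; _⊓_; _≤_; _<_; z≤n; s≤s; _*_; _^_)
open import Data.Nat.Properties using (≤-trans; ≰⇒>; anyUpTo?; m≤n⇒m⊓n≡m; m≥n⇒m⊓n≡n; <⇒≤; <⇒≱)
  renaming (_≤?_ to _≤ℕ?_)
open import Data.Nat.Induction using (<-rec)
open import Data.Fin using (Fin; zero; suc; fromℕ<; finToFun; funToFin; combine)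
open import Data.Fin.Patterns using (0F; 1F; 2F)
open import Data.Fin.Properties
  using (_≟_; _≤?_; all?; any?; ≤-antisym; ≤-total; finToFun-funToFin; combine-injective;
         injective⇒≤; fromℕ<-injective)
open import Data.Bool using (true)
open import Data.Bool.Properties using () renaming (_≟_ to _≟ᵇ_)
open import Data.List using (List; []; _∷_; length; _++_; reverse; lookup)
open import Data.List.Properties using (unfold-reverse; length-reverse)
open import Data.List.Membership.Propositional using (_∈_; _∉_)
open import Data.List.Membership.Propositional.Properties using (∈-++⁺ˡ; ∈-++⁺ʳ; ∈-lookup)
import Data.List.Membership.DecPropositional as DecMembership
open import Data.List.Relation.Binary.Disjoint.Propositional using (Disjoint)
open import Data.List.Relation.Binary.Permutation.Propositional using (↭-sym; ↭⇒↭ₛ)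
open import Data.List.Relation.Binary.Permutation.Propositional.Properties using (↭-reverse)
open import Data.List.Relation.Binary.Permutation.Setoid.Properties using (Unique-resp-↭)
open import Data.List.Relation.Binary.Subset.Propositional using (_⊆_)
open import Data.List.Relation.Unary.All as All using (All; []; _∷_)
open import Data.List.Relation.Unary.All.Properties using (¬Any⇒All¬; All¬⇒¬Any)
open import Data.List.Relation.Unary.AllPairs using ([]; _∷_)
open import Data.List.Relation.Unary.Any as Any using (here; there)
open import Data.List.Relation.Unary.Any.Properties using (lookup-index; reverse⁺; reverse⁻)
open import Data.List.Relation.Unary.Unique.Propositional using (Unique)
open import Data.List.Relation.Unary.Unique.Propositional.Properties using (++⁺)
import Data.List.Relation.Unary.Unique.DecPropositional as DecUnique
open import Data.Product using (Σ; ∃; ∃-syntax; _×_; _,_; proj₁; proj₂)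
open import Data.Sum using (_⊎_; inj₁; inj₂; [_,_]′; swap)
open import Data.Empty using (⊥-elim)
open import Axiom.UniquenessOfIdentityProofs using (module Decidable⇒UIP)
open Decidable⇒UIP _≟ᵇ_ using (≡-irrelevant)
open import Function using (_∘_; id)
open import Relation.Binary.PropositionalEquality
  using (_≡_; _≢_; refl; sym; trans; cong; cong₂; subst; ≢-sym; setoid)
open import Relation.Nullary using (¬_; Dec; yes; no; contradiction)
open import Relation.Nullary.Decidable using (map′; _×-dec_; _→-dec_; ¬?; _⊎-dec_)
open import Relation.Unary using (Decidable)

-- Repetition-free lists and least witnesses.

module _ {A : Set} where

  lookup-injective : {xs : List A} → Unique xs → ∀ {i j} → lookup xs i ≡ lookup xs j → i ≡ j
  lookup-injective (x∉ ∷ u) {zero}  {zero}  eq = refl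
  lookup-injective (x∉ ∷ u) {zero}  {suc j} eq = ⊥-elim (All.lookup x∉ (∈-lookup j) eq)
  lookup-injective (x∉ ∷ u) {suc i} {zero}  eq = ⊥-elim (All.lookup x∉ (∈-lookup i) (sym eq))
  lookup-injective (x∉ ∷ u) {suc i} {suc j} eq = cong suc (lookup-injective u eq)

  unique-reverse : {xs : List A} → Unique xs → Unique (reverse xs)
  unique-reverse {xs} = Unique-resp-↭ (setoid A) (↭⇒↭ₛ (↭-sym (↭-reverse xs)))

-- Pigeonhole: `lookup` embeds the positions of the list into `Fin m`.
unique-length : ∀ {m} {xs : List (Fin m)} → Unique xs → length xs ≤ m
unique-length u = injective⇒≤ (lookup-injective u)

distinct₃ : ∀ {A : Set} {a b c : A} → a ≢ b → b ≢ c → a ≢ c → Unique (a ∷ b ∷ c ∷ [])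
distinct₃ a≢b b≢c a≢c = (a≢b ∷ a≢c ∷ []) ∷ (b≢c ∷ []) ∷ [] ∷ []

least : {P : ℕ → Set} → Decidable P → ∀ m → P m → ∃[ r ] (P r × (∀ j → j < r → ¬ P j))
least {P} P? = <-rec _ (λ _ → step _)
  where
  step : ∀ m → (∀ {j} → j < m → P j → ∃[ r ] (P r × (∀ j → j < r → ¬ P j))) →
         P m → ∃[ r ] (P r × (∀ j → j < r → ¬ P j))
  step m rec Pm with anyUpTo? P? m
  ... | yes (j , j<m , Pj) = rec j<m Pj
  ... | no none            = m , Pm , λ j j<m Pj → none (j , j<m , Pj)

-- Loose and rainbow lists of colours.

module _ (G : Graph) where

  -- Distinct entries sit at distinct positions, so `Fin (length cs)` has three distinct elements.
  threeDistinct-length : ∀ {k} {cs : List (Fin k)} → ThreeDistinct G cs → 3 ≤ length cs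
  threeDistinct-length (_ , _ , _ , a∈ , b∈ , c∈ , a≢b , b≢c , a≢c) =
    unique-length (distinct₃ (apart a∈ b∈ a≢b) (apart b∈ c∈ b≢c) (apart a∈ c∈ a≢c))
    where
    apart : ∀ {k} {cs : List (Fin k)} {x y} (x∈ : x ∈ cs) (y∈ : y ∈ cs) → x ≢ y →
            Any.index x∈ ≢ Any.index y∈
    apart {cs = cs} x∈ y∈ x≢y eq =
      x≢y (trans (lookup-index x∈) (trans (cong (lookup cs) eq) (sym (lookup-index y∈))))

  threeDistinct⇒loose : ∀ {k} {cs : List (Fin k)} → ThreeDistinct G cs → LooseColours G cs
  threeDistinct⇒loose t = inj₂ (inj₂ (threeDistinct-length t , t))

  unique⇒loose : ∀ {k} {cs : List (Fin k)} → cs ≢ [] → Unique cs → LooseColours G cs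
  unique⇒loose {cs = []}             ne u = ⊥-elim (ne refl)
  unique⇒loose {cs = a ∷ []}         ne u = inj₁ refl
  unique⇒loose {cs = a ∷ b ∷ []}     ne ((a≢b ∷ []) ∷ _) = inj₂ (inj₁ (a , b , refl , a≢b))
  unique⇒loose {cs = a ∷ b ∷ c ∷ cs} ne ((a≢b ∷ a≢c ∷ _) ∷ (b≢c ∷ _) ∷ _) =
    threeDistinct⇒loose (a , b , c , here refl , there (here refl) , there (there (here refl)) ,
                         a≢b , b≢c , a≢c)

  -- `Fin k` has no three distinct elements when `k < 3`, which leaves only the clauses for one edge
  -- and for two edges.
  loose⇒unique : ∀ {k} {cs : List (Fin k)} → k < 3 → LooseColours G cs → Unique cs
  loose⇒unique {cs = a ∷ []} k<3 (inj₁ refl) = [] ∷ []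
  loose⇒unique k<3 (inj₂ (inj₁ (_ , _ , refl , a≢b))) = (a≢b ∷ []) ∷ [] ∷ []
  loose⇒unique k<3 (inj₂ (inj₂ (_ , _ , _ , _ , _ , _ , _ , a≢b , b≢c , a≢c))) =
    ⊥-elim (<⇒≱ k<3 (unique-length (distinct₃ a≢b b≢c a≢c)))

  loose-reverse : ∀ {k} {cs : List (Fin k)} → LooseColours G cs → LooseColours G (reverse cs)
  loose-reverse {cs = cs} (inj₁ one) = inj₁ (trans (length-reverse cs) one)
  loose-reverse (inj₂ (inj₁ (a , b , refl , a≢b))) = inj₂ (inj₁ (b , a , refl , ≢-sym a≢b))
  loose-reverse (inj₂ (inj₂ (_ , a , b , c , a∈ , b∈ , c∈ , ds))) =
    threeDistinct⇒loose (a , b , c , reverse⁺ a∈ , reverse⁺ b∈ , reverse⁺ c∈ , ds)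

  -- Walks, paths and ways to cut them.

  open Graph G using (n; Adj; irrefl) renaming (sym to Adj-sym)

  open DecMembership (_≟_ {n}) using (_∈?_)

  private
    variable
      k : ℕ
      u v w x y z : Fin n

  adj-sym : Adj u v ≡ true → Adj v u ≡ true
  adj-sym {u} {v} e = trans (Adj-sym v u) e

  adj⇒≢ : Adj u v ≡ true → u ≢ v
  adj⇒≢ {u} e refl with trans (sym e) (irrefl u)
  ... | ()

  start-∈ : (p : Walk G u v) → u ∈ verts G p
  start-∈ []      = here refl
  start-∈ (_ ∷ _) = here refl

  end-∈ : (p : Walk G u v) → v ∈ verts G p
  end-∈ []      = here refl
  end-∈ (_ ∷ p) = there (end-∈ p)

  infixr 5 _++ʷ_
  _++ʷ_ : Walk G u v → Walk G v w → Walk G u w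
  []      ++ʷ q = q
  (e ∷ p) ++ʷ q = e ∷ (p ++ʷ q)

  ++ʷ-∈⁻ : (p : Walk G u v) (q : Walk G v w) →
           x ∈ verts G (p ++ʷ q) → x ∈ verts G p ⊎ x ∈ verts G q
  ++ʷ-∈⁻ []      q x∈         = inj₂ x∈
  ++ʷ-∈⁻ (e ∷ p) q (here eq)  = inj₁ (here eq)
  ++ʷ-∈⁻ (e ∷ p) q (there x∈) = [ inj₁ ∘ there , inj₂ ]′ (++ʷ-∈⁻ p q x∈)

  -- Gluing along an edge, not at a shared vertex, makes the vertex list a plain concatenation, so
  -- disjoint paths glue to a path.
  join : Walk G u v → Adj v w ≡ true → Walk G w x → Walk G u x
  join p e q = p ++ʷ (e ∷ q)

  verts-join : (p : Walk G u v) (e : Adj v w ≡ true) (q : Walk G w x) →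
               verts G (join p e q) ≡ verts G p ++ verts G q
  verts-join []      e q = refl
  verts-join (_ ∷ p) e q = cong (_ ∷_) (verts-join p e q)

  colours-join : (φ : EdgeColouring G k) (p : Walk G u v) (e : Adj v w ≡ true) (q : Walk G w x) →
                 colours G φ (join p e q) ≡
                 colours G φ p ++ EdgeColouring.col φ v w ∷ colours G φ q
  colours-join φ []      e q = refl
  colours-join φ (_ ∷ p) e q = cong (_ ∷_) (colours-join φ p e q)

  join-path : (p : Walk G u v) (e : Adj v w ≡ true) (q : Walk G w x) →
              IsPath G p → IsPath G q → Disjoint (verts G p) (verts G q) → IsPath G (join p e q)
  join-path p e q up uq dis = subst Unique (sym (verts-join p e q)) (++⁺ up uq dis)

  rev : Walk G u v → Walk G v u
  rev []      = []
  rev (e ∷ p) = join (rev p) (adj-sym e) []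

  verts-rev : (p : Walk G u v) → verts G (rev p) ≡ reverse (verts G p)
  verts-rev []      = refl
  verts-rev (_∷_ {u} e p) = trans (verts-join (rev p) (adj-sym e) [])
    (trans (cong (_++ u ∷ []) (verts-rev p)) (sym (unfold-reverse u (verts G p))))

  colours-rev : (φ : EdgeColouring G k) (p : Walk G u v) →
                colours G φ (rev p) ≡ reverse (colours G φ p)
  colours-rev φ [] = refl
  colours-rev φ (_∷_ {u} {w} e p) = trans (colours-join φ (rev p) (adj-sym e) [])
    (trans (cong₂ (λ cs c → cs ++ c ∷ []) (colours-rev φ p) (EdgeColouring.colSym φ w u))
           (sym (unfold-reverse (EdgeColouring.col φ u w) (colours G φ p))))

  suffix : (p : Walk G u v) → w ∈ verts G p →
           Σ (Walk G w v) λ q → verts G q ⊆ verts G p × (IsPath G p → IsPath G q)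
  suffix []      (here refl) = [] , id , id
  suffix (e ∷ p) (here refl) = e ∷ p , id , id
  suffix (e ∷ p) (there w∈) with q , q⊆ , path ← suffix p w∈ =
    q , there ∘ q⊆ , λ { (_ ∷ up) → path up }

  -- A path visits its start only once, so a suffix that begins later misses it.
  suffix-avoiding-start : (p : Walk G u v) → IsPath G p → w ∈ verts G p → w ≢ u →
                          Σ (Walk G w v) λ q → verts G q ⊆ verts G p × u ∉ verts G q
  suffix-avoiding-start []      up       (here eq)  w≢u = ⊥-elim (w≢u eq)
  suffix-avoiding-start (e ∷ p) up       (here eq)  w≢u = ⊥-elim (w≢u eq)
  suffix-avoiding-start (e ∷ p) (u∉ ∷ _) (there w∈) w≢u with q , q⊆ , _ ← suffix p w∈ =
    q , there ∘ q⊆ , All¬⇒¬Any u∉ ∘ q⊆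

  -- Loop erasure: if the start recurs in the already cleaned tail, the tail is cut at that
  -- recurrence.
  toPath : (p : Walk G u v) → Σ (Walk G u v) λ q → IsPath G q × verts G q ⊆ verts G p
  toPath [] = [] , [] ∷ [] , id
  toPath (_∷_ {u} e p) with toPath p
  ... | q , uq , q⊆ with u ∈? verts G q
  ...   | yes u∈ with r , r⊆ , path ← suffix q u∈ = r , path uq , there ∘ q⊆ ∘ r⊆
  ...   | no  u∉ = e ∷ q , ¬Any⇒All¬ _ u∉ ∷ uq ,
                   λ { (here eq) → here eq ; (there x∈) → there (q⊆ x∈) }

  -- Stopping at the first vertex with `P` lets the detour of `linked-step` touch the existing walks
  -- only at its end.
  firstHit : {P : Fin n → Set} → Decidable P → (p : Walk G u v) → P v →
             ∃[ w ] (P w × w ∈ verts G p × Σ (Walk G u w) λ q →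
               verts G q ⊆ verts G p × (∀ {x} → x ∈ verts G q → x ≢ w → ¬ P x))
  firstHit {u = u} P? p Pv with P? u
  ... | yes Pu = u , Pu , start-∈ p , [] , (λ { (here refl) → start-∈ p }) ,
                 λ { (here eq) x≢u → ⊥-elim (x≢u eq) }
  firstHit P? [] Pv | no ¬Pu = ⊥-elim (¬Pu Pv)
  firstHit P? (e ∷ p) Pv | no ¬Pu with w , Pw , w∈ , q , q⊆ , before ← firstHit P? p Pv =
    w , Pw , there w∈ , e ∷ q ,
    (λ { (here eq) → here eq ; (there x∈) → there (q⊆ x∈) }) ,
    λ { (here refl) _ → ¬Pu ; (there x∈) → before x∈ }

  -- Disjoint walks from two vertices to the ends of an edge.

  Linked : (x y s t : Fin n) → Set
  Linked x y s t = Σ (Walk G x s) λ p → Σ (Walk G y t) λ q → Disjoint (verts G p) (verts G q)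

  module _ (conn : ∀ x → ConnectedWithout G x) where

    avoiding : u ≢ x → v ≢ x → Σ (Walk G u v) λ p → x ∉ verts G p
    avoiding {u} {x} {v} u≢x v≢x with p , _ , x∉ ← conn x u v u≢x v≢x =
      p , λ x∈ → All.lookup x∉ x∈ refl

    -- The only difficult case is when y′ lies on the path p from x.  Then a walk from x that avoids
    -- y′ is followed until it meets q or the part of p beyond y′; whichever of the two
    -- it misses continues y′.
    linked-step : ∀ {x y y′ s t} → Linked x y s t → Adj y y′ ≡ true → y′ ≢ x →
                  Linked x y′ s t ⊎ Linked x y′ t s
    linked-step {x} {y} {y′} {s} {t} (p , q , dis) e y′≢x with y′ ∈? verts G q
    ... | yes y′∈q with r , r⊆ , _ ← suffix q y′∈q =
      inj₁ (p , r , λ (a , b) → dis (a , r⊆ b))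
    ... | no y′∉q with y′ ∈? verts G p
    ...   | no y′∉p = inj₁ (p , adj-sym e ∷ q ,
              λ { (a , here refl) → y′∉p a ; (a , there b) → dis (a , b) })
    ...   | yes y′∈p with p₁ , p₁⊆ , _ ← suffix p y′∈p
                     -- Once the remainder is a path, `y′` occurs only at its start, so any later
                     -- piece avoids `y′`.
                     with p₂ , up₂ , p₂⊆ ← toPath p₁
                     with R , y′∉R ← avoiding {x} {y′} {t} (≢-sym y′≢x) (λ { refl → y′∉q (end-∈ q) })
                     with firstHit (λ z → z ∈? verts G q ⊎-dec z ∈? verts G p₂)
                                   R (inj₁ (end-∈ q))
    -- The detour reaches `q`: `x` takes over the rest of `q` and `y′` keeps the end of `p`, so the
    -- targets are exchanged.
    ...     | w , inj₁ w∈q , w∈R , r , r⊆ , before with q₁ , q₁⊆ , _ ← suffix q w∈q =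
              inj₂ (r ++ʷ q₁ , p₂ , λ (a , b) →
                [ (λ a∈r → before a∈r (λ { refl → dis (p₁⊆ (p₂⊆ b) , w∈q) }) (inj₂ b))
                , (λ a∈q₁ → dis (p₁⊆ (p₂⊆ b) , q₁⊆ a∈q₁)) ]′ (++ʷ-∈⁻ r q₁ a))
    ...     | w , inj₂ w∈p₂ , w∈R , r , r⊆ , before
              with p₃ , p₃⊆ , y′∉p₃ ← suffix-avoiding-start p₂ up₂ w∈p₂ (λ { refl → y′∉R w∈R }) =
              inj₁ (r ++ʷ p₃ , adj-sym e ∷ q ,
                λ { (a , here refl) → [ y′∉R ∘ r⊆ , y′∉p₃ ]′ (++ʷ-∈⁻ r p₃ a)
                  ; (a , there b) →
                      [ (λ a∈r → before a∈r (λ { refl → dis (p₁⊆ (p₂⊆ w∈p₂) , b) }) (inj₁ b))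
                      , (λ a∈p₃ → dis (p₁⊆ (p₂⊆ (p₃⊆ a∈p₃)) , b)) ]′ (++ʷ-∈⁻ r p₃ a) })

    linked-along : ∀ {x y v s t} → Linked x y s t ⊎ Linked x y t s → (p : Walk G y v) →
                   x ∉ verts G p → Linked x v s t ⊎ Linked x v t s
    linked-along l [] x∉ = l
    linked-along l (e ∷ p) x∉ =
      linked-along ([ (λ l → linked-step l e y′≢x) , (λ l → swap (linked-step l e y′≢x)) ]′ l)
                   p (x∉ ∘ there)
      where y′≢x = λ { refl → x∉ (there (start-∈ p)) }

    -- A case of Menger's theorem. The second end starts at `t` with the trivial walk, disjoint from
    -- a walk from `u` to `s` that avoids `t`; it is then moved to `v` along a walk that avoids `u`.
    linked : ∀ {u v s t} → u ≢ v → u ≢ t → s ≢ t → Linked u v s t ⊎ Linked u v t s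
    linked {u} {v} {s} {t} u≢v u≢t s≢t
      with p , t∉p ← avoiding {u} {t} {s} u≢t s≢t
      with q , u∉q ← avoiding {t} {u} {v} (≢-sym u≢t) (≢-sym u≢v) =
      linked-along (inj₁ (p , [] , λ { (a , here refl) → t∉p a })) q u∉q

  -- Kinds of vertices and the three-colouring.

  LooselyJoined : EdgeColouring G k → Fin n → Fin n → Set
  LooselyJoined φ u v = ∃[ p ] (IsPath G {u} {v} p × Loose G φ p)

  looselyJoined-sym : (φ : EdgeColouring G k) → LooselyJoined φ u v → LooselyJoined φ v u
  looselyJoined-sym φ (p , up , lp) =
    rev p , subst Unique (sym (verts-rev p)) (unique-reverse up) ,
    subst (LooseColours G) (sym (colours-rev φ p)) (loose-reverse lp)

  adj⇒looselyJoined : (φ : EdgeColouring G k) → Adj u v ≡ true → LooselyJoined φ u v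
  adj⇒looselyJoined φ e = e ∷ [] , (adj⇒≢ e ∷ []) ∷ [] ∷ [] , inj₁ refl

  data Kind : Set where
    S T A B Z : Kind

  -- A, B and Z stand for N(s), N(t) ∖ N(s) and the vertices adjacent to neither; classify tests
  -- s before t, which keeps N(s) ∩ N(t) out of B.
  data HasKind (s t x : Fin n) : Kind → Set where
    isS : x ≡ s → HasKind s t x S
    isT : x ≢ s → x ≡ t → HasKind s t x T
    isA : x ≢ s → x ≢ t → Adj s x ≡ true → HasKind s t x A
    isB : x ≢ s → x ≢ t → Adj t x ≡ true → HasKind s t x B
    isZ : x ≢ s → x ≢ t → Adj s x ≢ true → Adj t x ≢ true → HasKind s t x Z

  abstract
    classify : ∀ s t x → ∃ (HasKind s t x)
    classify s t x with x ≟ s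
    ... | yes x≡s = S , isS x≡s
    ... | no x≢s with x ≟ t
    ...   | yes x≡t = T , isT x≢s x≡t
    ...   | no x≢t with Adj s x ≟ᵇ true
    ...     | yes sx = A , isA x≢s x≢t sx
    ...     | no ¬sx with Adj t x ≟ᵇ true
    ...       | yes tx = B , isB x≢s x≢t tx
    ...       | no ¬tx = Z , isZ x≢s x≢t ¬sx ¬tx

  -- An edge from `Z` to `A` has colour 1 and the next edge from `A` to `s` has colour 0; through
  -- `B` to `t` the order is 0, 1. So leaving `Z` always shows both, and colour 2 comes from inside
  -- `Z` or from the edge `st`. Pairs such as `S`, `Z` that are never adjacent take the default of
  -- `S` or `T`, so that `colour-to-s` and `colour-from-t` can speak of all vertices.
  kindColour : Kind → Kind → Fin 3
  kindColour S T = 2F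
  kindColour T S = 2F
  kindColour S _ = 0F
  kindColour _ S = 0F
  kindColour T _ = 1F
  kindColour _ T = 1F
  kindColour A Z = 1F
  kindColour Z A = 1F
  kindColour B Z = 0F
  kindColour Z B = 0F
  kindColour _ _ = 2F

  kindColour-sym : ∀ a b → kindColour a b ≡ kindColour b a
  kindColour-sym S S = refl
  kindColour-sym S T = refl
  kindColour-sym S A = refl
  kindColour-sym S B = refl
  kindColour-sym S Z = refl
  kindColour-sym T S = refl
  kindColour-sym T T = refl
  kindColour-sym T A = refl
  kindColour-sym T B = refl
  kindColour-sym T Z = refl
  kindColour-sym A S = refl
  kindColour-sym A T = refl
  kindColour-sym A A = refl
  kindColour-sym A B = refl
  kindColour-sym A Z = refl
  kindColour-sym B S = refl
  kindColour-sym B T = refl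
  kindColour-sym B A = refl
  kindColour-sym B B = refl
  kindColour-sym B Z = refl
  kindColour-sym Z S = refl
  kindColour-sym Z T = refl
  kindColour-sym Z A = refl
  kindColour-sym Z B = refl
  kindColour-sym Z Z = refl

  -- Pairs of vertices outside the chosen edge.

  module _ (conn : ∀ x → ConnectedWithout G x) {s t : Fin n} (st : Adj s t ≡ true) where

    private
      s≢t : s ≢ t
      s≢t = adj⇒≢ st

      kind : Fin n → Kind
      kind x = proj₁ (classify s t x)

      hasKind : ∀ x → HasKind s t x (kind x)
      hasKind x = proj₂ (classify s t x)

      φ : EdgeColouring G 3
      φ = record { col = λ x y → kindColour (kind x) (kind y)
                 ; colSym = λ x y → kindColour-sym (kind x) (kind y) }

      open EdgeColouring φ using (col)

    kind-s : kind s ≡ S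
    kind-s with classify s t s
    ... | S , _ = refl
    ... | T , isT s≢s _ = ⊥-elim (s≢s refl)
    ... | A , isA s≢s _ _ = ⊥-elim (s≢s refl)
    ... | B , isB s≢s _ _ = ⊥-elim (s≢s refl)
    ... | Z , isZ s≢s _ _ _ = ⊥-elim (s≢s refl)

    kind-t : kind t ≡ T
    kind-t with classify s t t
    ... | S , isS t≡s = ⊥-elim (s≢t (sym t≡s))
    ... | T , _ = refl
    ... | A , isA _ t≢t _ = ⊥-elim (t≢t refl)
    ... | B , isB _ t≢t _ = ⊥-elim (t≢t refl)
    ... | Z , isZ _ t≢t _ _ = ⊥-elim (t≢t refl)

    colour-by : ∀ {x y a b} → kind x ≡ a → kind y ≡ b → col x y ≡ kindColour a b
    colour-by = cong₂ kindColour

    colour-to-s : ∀ x → x ≢ t → col x s ≡ 0F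
    colour-to-s x x≢t = trans (cong (kindColour (kind x)) kind-s) (by-kind (hasKind x))
      where
      by-kind : ∀ {a} → HasKind s t x a → kindColour a S ≡ 0F
      by-kind (isS _)       = refl
      by-kind (isT _ x≡t)   = ⊥-elim (x≢t x≡t)
      by-kind (isA _ _ _)   = refl
      by-kind (isB _ _ _)   = refl
      by-kind (isZ _ _ _ _) = refl

    colour-from-t : ∀ x → x ≢ s → col t x ≡ 1F
    colour-from-t x x≢s = trans (cong (λ a → kindColour a (kind x)) kind-t) (by-kind (hasKind x))
      where
      by-kind : ∀ {a} → HasKind s t x a → kindColour T a ≡ 1F
      by-kind (isS x≡s)     = ⊥-elim (x≢s x≡s)
      by-kind (isT _ _)     = refl
      by-kind (isA _ _ _)   = refl
      by-kind (isB _ _ _)   = refl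
      by-kind (isZ _ _ _ _) = refl

    -- The first edge that enters `s` does not come from `t`, hence has colour 0.
    0F-on-walk-to-s : ∀ {x} (p : Walk G x s) → x ≢ s → t ∉ verts G p → 0F ∈ colours G φ p
    0F-on-walk-to-s [] x≢s t∉ = ⊥-elim (x≢s refl)
    0F-on-walk-to-s (_∷_ {u} {w} e p) x≢s t∉ with w ≟ s
    ... | yes refl = here (sym (colour-to-s u (λ { refl → t∉ (here refl) })))
    ... | no w≢s   = there (0F-on-walk-to-s p w≢s (t∉ ∘ there))

    1F-on-walk-from-t : ∀ {y} (q : Walk G t y) → y ≢ t → s ∉ verts G q → 1F ∈ colours G φ q
    1F-on-walk-from-t [] y≢t s∉ = ⊥-elim (y≢t refl)
    1F-on-walk-from-t (_∷_ {w = w} e q) y≢t s∉ =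
      here (sym (colour-from-t w (λ { refl → s∉ (there (start-∈ q)) })))

    -- Since `u ≢ s` and `v ≢ t`, both halves contain an edge, and disjointness keeps each half off
    -- the far end of `st`. The half at `s` gives 0, the half at `t` gives 1, and `st` gives 2.
    -- Walks are turned into paths only here.
    linked⇒looselyJoined : ∀ {u v} → u ≢ s → v ≢ t → Linked u v s t → LooselyJoined φ u v
    linked⇒looselyJoined {u} {v} u≢s v≢t (p , q , dis)
      with p₁ , up₁ , p₁⊆ ← toPath p
      with q₁ , uq₁ , q₁⊆ ← toPath (rev q) =
      join p₁ st q₁ ,
      join-path p₁ st q₁ up₁ uq₁ dis₁ ,
      subst (LooseColours G) (sym (colours-join φ p₁ st q₁))
        (threeDistinct⇒loose
          ( 0F , 1F , 2F
          , ∈-++⁺ˡ (0F-on-walk-to-s p₁ u≢s λ t∈ → dis₁ (t∈ , start-∈ q₁))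
          , ∈-++⁺ʳ (colours G φ p₁) (there (1F-on-walk-from-t q₁ v≢t λ s∈ → dis₁ (end-∈ p₁ , s∈)))
          , ∈-++⁺ʳ (colours G φ p₁) (here (sym (colour-by kind-s kind-t)))
          , (λ ()) , (λ ()) , λ ()))
      where
      dis₁ : Disjoint (verts G p₁) (verts G q₁)
      dis₁ (a , b) = dis (p₁⊆ a , reverse⁻ (subst (_ ∈_) (verts-rev q) (q₁⊆ b)))

    -- Pairs that contain an end of the chosen edge.

    record Exit (v : Fin n) : Set where
      field
        {last door} : Fin n
        inside      : Walk G v last
        inside-path : IsPath G inside
        inside-Z    : All (λ x → kind x ≡ Z) (verts G inside)
        step        : Adj last door ≡ true
        door-AB     : kind door ≡ A × Adj door s ≡ true ⊎ kind door ≡ B × Adj door t ≡ true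

    kinded : ∀ {x a} → kind x ≡ a → HasKind s t x a
    kinded {x} refl = hasKind x

    -- The walk must leave `Z`, as `s` is not in it. A vertex of `Z` is adjacent to neither `s` nor
    -- `t`, so the first vertex outside lies in `A` or `B`.
    exit : ∀ {v} → kind v ≡ Z → Walk G v s → Exit v
    exit kv [] with trans (sym kind-s) kv
    ... | ()
    exit {v} kv (_∷_ {w = w} e p) = by-kind (kind w) refl (hasKind w)
      where
      last-step : kind w ≡ A × Adj w s ≡ true ⊎ kind w ≡ B × Adj w t ≡ true → Exit v
      last-step ab = record { inside = [] ; inside-path = [] ∷ [] ; inside-Z = kv ∷ []
                            ; step = e ; door-AB = ab }

      by-kind : ∀ a → kind w ≡ a → HasKind s t w a → Exit v
      by-kind S kw (isS refl) with isZ _ _ ¬sv _ ← kinded kv = ⊥-elim (¬sv (adj-sym e))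
      by-kind T kw (isT _ refl) with isZ _ _ _ ¬tv ← kinded kv = ⊥-elim (¬tv (adj-sym e))
      by-kind A kw (isA _ _ sw) = last-step (inj₁ (kw , adj-sym sw))
      by-kind B kw (isB _ _ tw) = last-step (inj₂ (kw , adj-sym tw))
      -- The inner path may already visit `v`, so loops are erased again; no new vertices appear and
      -- the path stays in `Z`.
      by-kind Z kw _ with record { inside = q ; inside-Z = zs ; step = f ; door-AB = ab } ← exit kw p
                     with r , ur , r⊆ ← toPath (e ∷ q) =
        record { inside = r ; inside-path = ur
               ; inside-Z = All.tabulate (All.lookup (kv ∷ zs) ∘ r⊆) ; step = f ; door-AB = ab }

    2F-inside-Z : ∀ {u v} (p : Walk G u v) → All (λ x → kind x ≡ Z) (verts G p) →
                  colours G φ p ≡ [] ⊎ 2F ∈ colours G φ p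
    2F-inside-Z []            zs            = inj₁ refl
    2F-inside-Z (e ∷ [])      (zu ∷ zw ∷ _) = inj₂ (here (sym (colour-by zu zw)))
    2F-inside-Z (e ∷ (_ ∷ _)) (zu ∷ zw ∷ _) = inj₂ (here (sym (colour-by zu zw)))

    -- The two pieces are disjoint because one lies inside `Z` and the other outside.
    exit-path : ∀ {v x} (ex : Exit v) (q : Walk G (Exit.door ex) x) → IsPath G q →
                All (λ y → kind y ≢ Z) (verts G q) →
                IsPath G (join (Exit.inside ex) (Exit.step ex) q)
    exit-path ex q uq ¬zs = join-path inside step q inside-path uq
      λ (a , b) → All.lookup ¬zs b (All.lookup inside-Z a)
      where open Exit ex

    door≢Z : ∀ {v} (ex : Exit v) → kind (Exit.door ex) ≢ Z
    door≢Z ex kz with Exit.door-AB ex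
    ... | inj₁ (ka , _) with () ← trans (sym ka) kz
    ... | inj₂ (kb , _) with () ← trans (sym kb) kz

    -- If the part inside `Z` is a single vertex, two edges of different colours remain; otherwise
    -- that part supplies colour 2 as the third.
    exit-edge : ∀ {v x a b} (ex : Exit v) (f : Adj (Exit.door ex) x ≡ true) → kind x ≢ Z →
                col (Exit.last ex) (Exit.door ex) ≡ a → col (Exit.door ex) x ≡ b →
                a ≢ b → b ≢ 2F → a ≢ 2F → LooselyJoined φ v x
    exit-edge {a = a} {b} ex f x≢Z ca cb a≢b b≢2 a≢2 =
      join inside step (f ∷ []) ,
      exit-path ex (f ∷ []) ((adj⇒≢ f ∷ []) ∷ [] ∷ []) (door≢Z ex ∷ x≢Z ∷ []) ,
      subst (LooseColours G) (sym (trans (colours-join φ inside step (f ∷ []))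
              (cong₂ (λ a b → colours G φ inside ++ a ∷ b ∷ []) ca cb)))
            loose
      where
      open Exit ex
      loose : LooseColours G (colours G φ inside ++ a ∷ b ∷ [])
      loose with 2F-inside-Z inside inside-Z
      ... | inj₁ none rewrite none = inj₂ (inj₁ (a , b , refl , a≢b))
      ... | inj₂ 2F∈ = threeDistinct⇒loose
        (a , b , 2F , ∈-++⁺ʳ (colours G φ inside) (here refl)
        , ∈-++⁺ʳ (colours G φ inside) (there (here refl)) , ∈-++⁺ˡ 2F∈ , a≢b , b≢2 , a≢2)

    -- Serves the end of `st` on the far side of the door: the last edge is then `st`, which brings
    -- colour 2 whatever happens inside `Z`.
    exit-edge² : ∀ {v x y a b} (ex : Exit v)
                 (f : Adj (Exit.door ex) x ≡ true) (g : Adj x y ≡ true) →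
                 Exit.door ex ≢ y → kind x ≢ Z → kind y ≢ Z →
                 col (Exit.last ex) (Exit.door ex) ≡ a → col (Exit.door ex) x ≡ b →
                 col x y ≡ 2F → a ≢ b → b ≢ 2F → a ≢ 2F → LooselyJoined φ v y
    exit-edge² {a = a} {b} ex f g door≢y x≢Z y≢Z ca cb cc a≢b b≢2 a≢2 =
      join inside step q ,
      exit-path ex q ((adj⇒≢ f ∷ door≢y ∷ []) ∷ (adj⇒≢ g ∷ []) ∷ [] ∷ [])
                (door≢Z ex ∷ x≢Z ∷ y≢Z ∷ []) ,
      subst (LooseColours G) (sym (colours-join φ inside step q))
        (threeDistinct⇒loose
          ( a , b , 2F
          , ∈-++⁺ʳ (colours G φ inside) (here (sym ca))
          , ∈-++⁺ʳ (colours G φ inside) (there (here (sym cb)))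
          , ∈-++⁺ʳ (colours G φ inside) (there (there (here (sym cc))))
          , a≢b , b≢2 , a≢2))
      where
      open Exit ex
      q = f ∷ g ∷ []

    last-Z : ∀ {v} (ex : Exit v) → kind (Exit.last ex) ≡ Z
    last-Z ex = All.lookup (Exit.inside-Z ex) (end-∈ (Exit.inside ex))

    kind-≢Z : ∀ {x a} → kind x ≡ a → a ≢ Z → kind x ≢ Z
    kind-≢Z ka a≢Z kz = a≢Z (trans (sym ka) kz)

    s≢Z : kind s ≢ Z
    s≢Z = kind-≢Z kind-s λ ()

    t≢Z : kind t ≢ Z
    t≢Z = kind-≢Z kind-t λ ()

    -- A door in `A` gives the final colours 1, 0; a door in `B` leads through `t` with 0, 1, 2.
    Z-to-s : ∀ {v} → Exit v → LooselyJoined φ v s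
    Z-to-s ex with Exit.door-AB ex
    ... | inj₁ (ka , f) = exit-edge ex f s≢Z (colour-by (last-Z ex) ka) (colour-by ka kind-s)
                                    (λ ()) (λ ()) (λ ())
    ... | inj₂ (kb , f) with isB b≢s _ _ ← kinded kb =
      exit-edge² ex f (adj-sym st) b≢s t≢Z s≢Z
                 (colour-by (last-Z ex) kb) (colour-by kb kind-t) (colour-by kind-t kind-s)
                 (λ ()) (λ ()) (λ ())

    Z-to-t : ∀ {v} → Exit v → LooselyJoined φ v t
    Z-to-t ex with Exit.door-AB ex
    ... | inj₂ (kb , f) = exit-edge ex f t≢Z (colour-by (last-Z ex) kb) (colour-by kb kind-t)
                                    (λ ()) (λ ()) (λ ())
    ... | inj₁ (ka , f) with isA _ a≢t _ ← kinded ka =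
      exit-edge² ex f st a≢t s≢Z t≢Z
                 (colour-by (last-Z ex) ka) (colour-by ka kind-s) (colour-by kind-s kind-t)
                 (λ ()) (λ ()) (λ ())

    two-edges : ∀ {u v w} → Adj u w ≡ true → Adj w v ≡ true → u ≢ v → col u w ≢ col w v →
                LooselyJoined φ u v
    two-edges e f u≢v c≢ = e ∷ f ∷ [] ,
      (adj⇒≢ e ∷ u≢v ∷ []) ∷ (adj⇒≢ f ∷ []) ∷ [] ∷ [] , inj₂ (inj₁ (_ , _ , refl , c≢))

    to-s : ∀ {v} → Walk G v s → v ≢ s → LooselyJoined φ v s
    to-s {v} p v≢s = by-kind (kind v) refl (hasKind v)
      where
      by-kind : ∀ a → kind v ≡ a → HasKind s t v a → LooselyJoined φ v s
      by-kind S kv (isS v≡s) = ⊥-elim (v≢s v≡s)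
      by-kind T kv (isT _ refl) = adj⇒looselyJoined φ (adj-sym st)
      by-kind A kv (isA _ _ sv) = adj⇒looselyJoined φ (adj-sym sv)
      by-kind B kv (isB _ _ tv) = two-edges (adj-sym tv) (adj-sym st) v≢s λ eq →
        contradiction (trans (sym (colour-by kv kind-t)) (trans eq (colour-by kind-t kind-s))) λ ()
      by-kind Z kv _ = Z-to-s (exit kv p)

    -- The walk still ends in `s`, because `exit` only uses it to leave `Z`.
    to-t : ∀ {v} → Walk G v s → v ≢ t → LooselyJoined φ v t
    to-t {v} p v≢t = by-kind (kind v) refl (hasKind v)
      where
      by-kind : ∀ a → kind v ≡ a → HasKind s t v a → LooselyJoined φ v t
      by-kind S kv (isS refl) = adj⇒looselyJoined φ st
      by-kind T kv (isT _ v≡t) = ⊥-elim (v≢t v≡t)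
      by-kind A kv (isA _ _ sv) = two-edges (adj-sym sv) st v≢t λ eq →
        contradiction (trans (sym (colour-by kv kind-s)) (trans eq (colour-by kind-s kind-t))) λ ()
      by-kind B kv (isB _ _ tv) = adj⇒looselyJoined φ (adj-sym tv)
      by-kind Z kv _ = Z-to-t (exit kv p)

    edge-colouring-looseConnecting : Connected G → LooseConnecting G φ
    edge-colouring-looseConnecting connected u v u≢v with u ≟ s | v ≟ s | u ≟ t | v ≟ t
    ... | _ | yes refl | _ | _ = to-s (proj₁ (connected u s)) u≢v
    ... | yes refl | _ | _ | _ =
      looselyJoined-sym φ (to-s (proj₁ (connected v s)) (≢-sym u≢v))
    ... | _ | _ | _ | yes refl = to-t (proj₁ (connected u s)) u≢v
    ... | _ | _ | yes refl | _ =
      looselyJoined-sym φ (to-t (proj₁ (connected v s)) (≢-sym u≢v))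
    ... | no u≢s | no v≢s | no u≢t | no v≢t with linked conn u≢v u≢t s≢t
    ...   | inj₁ l = linked⇒looselyJoined u≢s v≢t l
    -- Here `u` is linked to `t` and `v` to `s`, so the pair is treated in reverse order.
    ...   | inj₂ (p , q , dis) = looselyJoined-sym φ
              (linked⇒looselyJoined v≢s u≢t (q , p , λ (a , b) → dis (b , a)))

  someEdge : 3 ≤ n → Connected G → ∃[ s ] ∃[ t ] Adj s t ≡ true
  someEdge 3≤n connected = first-edge (proj₁ (connected zeroth first))
    λ eq → contradiction (fromℕ<-injective 0 1 0<n 1<n eq) λ ()
    where
    0<n : 0 < n
    0<n = ≤-trans (s≤s z≤n) 3≤n
    1<n : 1 < n
    1<n = ≤-trans (s≤s (s≤s z≤n)) 3≤n
    zeroth first : Fin n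
    zeroth = fromℕ< 0<n
    first  = fromℕ< 1<n
    first-edge : ∀ {u v} → Walk G u v → u ≢ v → ∃[ s ] ∃[ t ] Adj s t ≡ true
    first-edge []      u≢u = ⊥-elim (u≢u refl)
    first-edge (e ∷ _) _   = _ , _ , e

  looseConnecting₃ : TwoConnected G → ∃[ φ ] LooseConnecting G {3} φ
  looseConnecting₃ (3≤n , connected , conn) with _ , _ , st ← someEdge 3≤n connected =
    _ , edge-colouring-looseConnecting conn st connected

  -- Comparison of loose and rainbow connection.

  rainbow⇒looseConnecting : (φ : EdgeColouring G k) → RainbowConnecting G φ → LooseConnecting G φ
  rainbow⇒looseConnecting φ rc u v u≢v with rc u v u≢v
  ... | []    , up , rp = ⊥-elim (u≢v refl)
  ... | e ∷ p , up , rp = e ∷ p , up , unique⇒loose (λ ()) rp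

  loose⇒rainbowConnecting : k < 3 → (φ : EdgeColouring G k) →
                            LooseConnecting G φ → RainbowConnecting G φ
  loose⇒rainbowConnecting k<3 φ lc u v u≢v with p , up , lp ← lc u v u≢v =
    p , up , loose⇒unique k<3 lp

  -- A colouring that makes every path rainbow.

  -- Sorting the end points makes this injective on unordered pairs.
  pairColour : Fin n → Fin n → Fin (n * n)
  pairColour u v with u ≤? v
  ... | yes _ = combine u v
  ... | no  _ = combine v u

  pairColour-sym : ∀ u v → pairColour u v ≡ pairColour v u
  pairColour-sym u v with u ≤? v | v ≤? u
  ... | yes u≤v | yes v≤u with refl ← ≤-antisym u≤v v≤u = refl
  ... | yes u≤v | no  _   = refl
  ... | no  _   | yes v≤u = refl
  ... | no u≰v  | no v≰u  = ⊥-elim ([ u≰v , v≰u ]′ (≤-total u v))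

  -- Locating one end point is enough: on a path, the start of an edge does not occur among the ends
  -- of later edges.
  pairColour-injective : ∀ u v x y → pairColour u v ≡ pairColour x y → u ≡ x ⊎ u ≡ y
  pairColour-injective u v x y eq with u ≤? v | x ≤? y
  ... | yes _ | yes _ = inj₁ (proj₁ (combine-injective u v x y eq))
  ... | yes _ | no  _ = inj₂ (proj₁ (combine-injective u v y x eq))
  ... | no  _ | yes _ = inj₂ (proj₂ (combine-injective v u x y eq))
  ... | no  _ | no  _ = inj₁ (proj₂ (combine-injective v u y x eq))

  pairColouring : EdgeColouring G (n * n)
  pairColouring = record { col = pairColour ; colSym = pairColour-sym }

  path⇒pairRainbow : (p : Walk G u v) → IsPath G p → Rainbow G pairColouring p
  path⇒pairRainbow []      _         = []
  path⇒pairRainbow (_∷_ {u} {w} e p) (u∉ ∷ up) =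
    All.tabulate (λ { c∈ refl → fresh p u∉ c∈ }) ∷ path⇒pairRainbow p up
    where
    fresh : ∀ {x y} (q : Walk G x y) → All (u ≢_) (verts G q) →
            pairColour u w ∉ colours G pairColouring q
    fresh (_∷_ {x} {y} f q) (u≢x ∷ u≢) (here eq) =
      [ u≢x , All.lookup u≢ (start-∈ q) ]′ (pairColour-injective u w x y eq)
    fresh (f ∷ q) (_ ∷ u≢) (there c∈) = fresh q u≢ c∈

  -- Deciding rainbow connection by finite search.

  walkLength : Walk G u v → ℕ
  walkLength []      = 0
  walkLength (_ ∷ p) = suc (walkLength p)

  length-verts : (p : Walk G u v) → length (verts G p) ≡ suc (walkLength p)
  length-verts []      = refl
  length-verts (_ ∷ p) = cong suc (length-verts p)

  path-length : (p : Walk G u v) → IsPath G p → walkLength p ≤ n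
  path-length p up = <⇒≤ (subst (_≤ n) (length-verts p) (unique-length up))

  -- The search branches over the first edge. An arbitrary `P` lets the recursive call carry the
  -- edges already chosen inside the predicate.
  boundedWalk? : ∀ m u v {P : Walk G u v → Set} → Decidable P →
                 Dec (∃[ p ] (walkLength p ≤ m × P p))
  boundedWalk? m u v {P} P? with trivial? | longer? m
    where
    Trivial = Σ (u ≡ v) λ eq → P (subst (Walk G u) eq [])
    Longer : ℕ → Set
    Longer m = ∃[ w ] Σ (Adj u w ≡ true) λ e → ∃[ p ] (suc (walkLength p) ≤ m × P (e ∷ p))
    trivial? : Dec Trivial
    trivial? with u ≟ v
    ... | yes refl = map′ (refl ,_) (λ { (refl , P[]) → P[] }) (P? [])
    ... | no u≢v   = no (u≢v ∘ proj₁)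
    longer? : ∀ m → Dec (Longer m)
    longer? zero    = no λ { (_ , _ , _ , () , _) }
    longer? (suc m) = any? λ w → via w
      where
      via : ∀ w → Dec (Σ (Adj u w ≡ true) λ e → ∃[ p ] (suc (walkLength p) ≤ suc m × P (e ∷ p)))
      via w with Adj u w ≟ᵇ true
      ... | no ¬e = no (¬e ∘ proj₁)
      ... | yes e = map′ (λ (p , l , Pp) → e , p , s≤s l , Pp)
                         -- The search tried the one proof `e` of adjacency; equality proofs in
                         -- `Bool` are unique, so a walk that starts with `e′` is covered.
                         (λ { (e′ , p , s≤s l , Pp) → p , l , subst (λ e → P (e ∷ p)) (≡-irrelevant e′ e) Pp })
                         (boundedWalk? m w v (P? ∘ (e ∷_)))
  ... | yes (refl , P[]) | _ = yes ([] , z≤n , P[])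
  ... | _ | yes (w , e , p , l , Pp) = yes (e ∷ p , l , Pp)
  ... | no ¬t | no ¬l = no λ { ([] , _ , P[])    → ¬t (refl , P[])
                             ; (e ∷ p , l , Pp) → ¬l (_ , e , p , l , Pp) }

  -- `path-length` confines the search to walks of length at most `n`.
  rainbowConnecting? : (φ : EdgeColouring G k) → Dec (RainbowConnecting G φ)
  rainbowConnecting? φ = all? λ u → all? λ v → ¬? (u ≟ v) →-dec
    map′ (λ (p , _ , P) → p , P) (λ (p , up , rp) → p , path-length p up , up , rp)
      (boundedWalk? n u v λ p →
        DecUnique.unique? _≟_ (verts G p) ×-dec DecUnique.unique? _≟_ (colours G φ p))

  colours-cong : (φ ψ : EdgeColouring G k) →
                 (∀ x y → EdgeColouring.col φ x y ≡ EdgeColouring.col ψ x y) →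
                 (p : Walk G u v) → colours G φ p ≡ colours G ψ p
  colours-cong φ ψ eq []      = refl
  colours-cong φ ψ eq (e ∷ p) = cong₂ _∷_ (eq _ _) (colours-cong φ ψ eq p)

  rainbowConnecting-cong : (φ ψ : EdgeColouring G k) →
                           (∀ x y → EdgeColouring.col φ x y ≡ EdgeColouring.col ψ x y) →
                           RainbowConnecting G φ → RainbowConnecting G ψ
  rainbowConnecting-cong φ ψ eq rc u v u≢v with p , up , rp ← rc u v u≢v =
    p , up , subst Unique (colours-cong φ ψ eq p) rp

  -- Colourings are functions, so the finite search runs over their codes in Fin ((k ^ n) ^ n).
  hasRainbowColouring? : ∀ k → Dec (∃[ φ ] RainbowConnecting G {k} φ)
  hasRainbowColouring? k = map′ (λ (i , σ , rc) → colouring i σ , rc) encode (any? good?)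
    where
    decode : Fin ((k ^ n) ^ n) → Fin n → Fin n → Fin k
    decode i u v = finToFun (finToFun {k ^ n} {n} i u) v

    Symmetric : Fin ((k ^ n) ^ n) → Set
    Symmetric i = ∀ u v → decode i u v ≡ decode i v u

    colouring : ∀ i → Symmetric i → EdgeColouring G k
    colouring i σ = record { col = decode i ; colSym = σ }

    good? : ∀ i → Dec (Σ (Symmetric i) λ σ → RainbowConnecting G (colouring i σ))
    good? i with all? (λ u → all? λ v → decode i u v ≟ decode i v u)
    ... | no ¬σ = no (¬σ ∘ proj₁)
    ... | yes σ = map′ (σ ,_)
      -- Two proofs of symmetry may differ, but the colour values are the same.
      (λ (σ′ , rc) → rainbowConnecting-cong (colouring i σ′) (colouring i σ) (λ _ _ → refl) rc)
      (rainbowConnecting? (colouring i σ))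

    encode : ∃[ φ ] RainbowConnecting G {k} φ →
             ∃[ i ] Σ (Symmetric i) λ σ → RainbowConnecting G (colouring i σ)
    encode (φ , rc) = i , σ , rainbowConnecting-cong φ (colouring i σ) (λ x y → sym (decode-i x y)) rc
      where
      open EdgeColouring φ
      i : Fin ((k ^ n) ^ n)
      i = funToFin (funToFin ∘ col)
      decode-i : ∀ x y → decode i x y ≡ col x y
      decode-i x y = trans (cong (λ r → finToFun r y) (finToFun-funToFin (funToFin ∘ col) x))
                           (finToFun-funToFin (col x) y)
      σ : Symmetric i
      σ u v = trans (decode-i u v) (trans (colSym u v) (sym (decode-i v u)))

  -- The numbers rc and lec.

  rc-exists : Connected G → ∃[ r ] IsRc G r
  rc-exists connected = least hasRainbowColouring? (n * n)
    (pairColouring , λ u v _ → let p , up = connected u v in p , up , path⇒pairRainbow p up)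

theorem2 : (G : Graph) → TwoConnected G →
    ∃[ r ] (IsRc G r × IsLec G (3 ⊓ r))
theorem2 G 2conn@(_ , connected , _) with r , isRc@((φ , rc) , minimal) ← rc-exists G connected =
  r , isRc , lec
  where
  -- Below three colours a loose colouring is a rainbow colouring, which the minimality of `r`
  -- excludes.
  no-loose : ∀ j → j < 3 → j < r → ¬ (∃[ φ ] LooseConnecting G {j} φ)
  no-loose j j<3 j<r (ψ , lc) = minimal j j<r (ψ , loose⇒rainbowConnecting G j<3 ψ lc)

  lec : IsLec G (3 ⊓ r)
  lec with 3 ≤ℕ? r
  ... | yes 3≤r rewrite m≤n⇒m⊓n≡m 3≤r =
    looseConnecting₃ G 2conn , λ j j<3 → no-loose j j<3 (≤-trans j<3 3≤r)
  -- The minimum is `r`, and the optimal rainbow colouring itself is loose.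
  ... | no 3≰r rewrite m≥n⇒m⊓n≡n (<⇒≤ (≰⇒> 3≰r)) =
    (φ , rainbow⇒looseConnecting G φ rc) ,
    λ j j<r → no-loose j (≤-trans j<r (<⇒≤ (≰⇒> 3≰r))) j<r
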